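{- Let $r\ge 2$, $n=2^r$, $M=2^{n-r}$, $\nu=2^{r-1}-1$. (1) If $\mathcal{C}^*$ is a zeroed ENP1CC of length $n+1$, then $A_i(\mathcal{C}^*)=0$ for odd $i$, $A_0(\mathcal{C}^*)=1$, and for even $i>0$, $$A_i(\mathcal{C}^*)=\frac{\binom{n+1}{i}+(n-1)(\Delta_{i-1}+\Delta_i)}{n}.$$ (2) If $\mathcal{C}^*$ is a non-zeroed ENP1CC of length $n+1$ with exactly one codeword of weight one, then $A_i(\mathcal{C}^*)=0$ for even $i$, $A_1(\mathcal{C}^*)=1$, and for odd $i>1$, $$A_i(\mathcal{C}^*)=\frac{\binom{n+1}{i}-(\Delta_{i-1}+\Delta_{i-2})}{n}.$$ (3) If $\mathcal{C}^*$ is a non-zeroed ENP1CC of length $n+1$ with exactly two codewords of weight one, then $A_i(\mathcal{C}^*)=0$ for even $i$, $A_1(\mathcal{C}^*)=2$, and for odd $i>1$, $$A_i(\mathcal{C}^*)=\frac{\binom{n+1}{i}+(n-1)(\Delta_{i-1}+\Delta_{i-2})}{n}.$$ (4) If $\mathcal{C}^*$ is a non-zeroed ENP1CC of length $n+1$ whose codewords have even weight, then $A_i(\mathcal{C}^*)=0$ for odd $i$, $A_0(\mathcal{C}^*)=0$, and for even $i>0$, $$A_i(\mathcal{C}^*)=\frac{\binom{n+1}{i}-(\Delta_i+\Delta_{i-1})}{n}.$$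
   Context: All codes are binary; $A_i(\mathcal{C})$ is the number of codewords of $\mathcal{C}$ of Hamming weight $i$. A code is zeroed if it contains the all-zero word, non-zeroed otherwise. An NP1CC of length $n=2^r$ is a code $\mathcal{C}\subseteq\mathbb{F}_2^n$ with $|\mathcal{C}|=2^{n-r}$ such that every word of $\mathbb{F}_2^n$ is at distance at most $1$ from some codeword. An ENP1CC is a code of length $n+1$ of the form $\{(\mathbf{c},p(\mathbf{c})):\mathbf{c}\in\mathcal{C}\}$ or $\{(\mathbf{c},1+p(\mathbf{c})):\mathbf{c}\in\mathcal{C}\}$ for an NP1CC $\mathcal{C}$, where $p(\mathbf{c})=\sum_i c_i\bmod 2$. For integers $i\ge 0$: $\Delta_i=\binom{\nu}{\lfloor i/2\rfloor}$ if $i\equiv 0,3\pmod 4$ and $\Delta_i=-\binom{\nu}{\lfloor i/2\rfloor}$ if $i\equiv 1,2\pmod 4$ (with $\binom{a}{b}=0$ for $b>a$). -}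

module Defs where

open import Data.Bool using (Bool; true; false; _xor_; _∧_; if_then_else_)
open import Data.Nat using (ℕ; zero; suc; _+_; _*_; _∸_; _^_; _≤_; _≡ᵇ_; _%_)
open import Data.Nat.Combinatorics using () renaming (_C_ to binom)
open import Data.Integer using (ℤ; +_; -_)
open import Data.Vec using (Vec; []; _∷_; zipWith; foldr; replicate; init; last)
open import Data.List using (List; []; _∷_; _++_; map; filter; length)
open import Data.Product using (Σ; _×_; ∃)
open import Relation.Binary.PropositionalEquality using (_≡_)

Word : ℕ → Set
Word m = Vec Bool m

Code : ℕ → Set
Code m = Word m → Bool

allWords : (m : ℕ) → List (Word m)
allWords zero = [] ∷ []
allWords (suc m) = map (false ∷_) (allWords m) ++ map (true ∷_) (allWords m)

countB : {A : Set} → (A → Bool) → List A → ℕ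
countB p [] = 0
countB p (x ∷ xs) = (if p x then 1 else 0) + countB p xs

weight : {m : ℕ} → Word m → ℕ
weight [] = 0
weight (b ∷ w) = (if b then 1 else 0) + weight w

dist : {m : ℕ} → Word m → Word m → ℕ
dist x y = weight (zipWith _xor_ x y)

parity : {m : ℕ} → Word m → Bool
parity = foldr _ _xor_ false

card : {m : ℕ} → Code m → ℕ
card {m} C = countB C (allWords m)

A : {m : ℕ} → Code m → ℕ → ℕ
A {m} C i = countB (λ w → C w ∧ (weight w ≡ᵇ i)) (allWords m)

zeroWord : (m : ℕ) → Word m
zeroWord m = replicate m false

Zeroed : {m : ℕ} → Code m → Set
Zeroed {m} C = C (zeroWord m) ≡ true

IsNP1CC : (r : ℕ) → Code (2 ^ r) → Set
IsNP1CC r C =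
  (card C ≡ 2 ^ (2 ^ r ∸ r)) ×
  ((x : Word (2 ^ r)) → Σ (Word (2 ^ r)) λ c → (C c ≡ true) × (dist x c ≤ 1))

extend : {m : ℕ} → Code m → Bool → Code (suc m)
extend C b w = C (init w) ∧ (last w ≡ᵇᵇ (b xor parity (init w)))
  where
  _≡ᵇᵇ_ : Bool → Bool → Bool
  true ≡ᵇᵇ true = true
  false ≡ᵇᵇ false = true
  _ ≡ᵇᵇ _ = false

IsENP1CC : (r : ℕ) → Code (suc (2 ^ r)) → Set
IsENP1CC r Cs =
  Σ (Code (2 ^ r)) λ C → Σ Bool λ b →
    IsNP1CC r C × ((w : Word (suc (2 ^ r))) → Cs w ≡ extend C b w)

Δ : ℕ → ℕ → ℤ
Δ ν i with i % 4
... | 0 = + (binom ν (i Data.Nat./ 2))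
... | 3 = + (binom ν (i Data.Nat./ 2))
... | _ = - (+ (binom ν (i Data.Nat./ 2)))

Even Odd : ℕ → Set
Even i = i % 2 ≡ 0
Odd i = i % 2 ≡ 1

{-# OPTIONS --safe #-}
-- Write m = 2^r, let f be the indicator of the underlying NP1CC and let S sum a function over
-- balls of radius 1.  Covering gives S f = 1 + e with e ≥ 0.  Conversely S e = 1 + f: since the ball
-- size m + 1 is odd and S S f ≡ f mod 2, S e ≥ 1 off the code, and double counting makes this tight
-- and forces e ∈ {0,1}; on the code S e ≤ 2 by a local argument, which is tight on average.
-- Putting f on the words of one parity and e on the words of the other parity of the
-- (m + 1)-cube yields a function F all of whose sphere sums are 1 + F, so that F - 1/m is an
-- eigenfunction for the eigenvalue 1.  Summing over weight layers gives a recurrence that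
-- determines all layer sums s_i of F from s_0, and A_i = s_i for i of the parity of the code.
module Submission where

open import Defs
open import Data.Nat using (ℕ; suc; _^_; _≤_; _<_; _∸_)
open import Data.Nat.Combinatorics using () renaming (_C_ to binom)
open import Data.Product using (_×_)
open import Data.Bool using (true)
open import Relation.Binary.PropositionalEquality using (_≡_)
open import Relation.Nullary using (¬_)
import Data.Nat as ℕ
import Data.Nat.Properties as ℕ
import Data.Nat.Tactic.RingSolver as ℕSolver
open import Data.Nat using (zero; z≤n; s≤s; _%_; _/_)
open import Data.Nat.Combinatorics using (nCk+nC[k+1]≡[n+1]C[k+1])
open import Data.Nat.Divisibility using (divides-refl)
open import Data.Nat.DivMod using ([m+n]%n≡m%n; m*n/n≡m; +-distrib-/-∣ʳ; m≡m%n+[m/n]*n)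
open import Data.Bool using (Bool; false; not; _xor_; _∧_; if_then_else_)
open import Data.Bool.Properties
  using (not-involutive; xor-same; xor-inverseʳ; ∧-zeroʳ; not-distribˡ-xor; not-distribʳ-xor)
open import Data.Fin using (Fin; zero; suc)
import Data.Fin.Properties as Fin
open import Data.List using ([]; _∷_; map; _++_)
open import Data.Product using (_,_; proj₁; proj₂; ∃; Σ)
open import Data.Sum using (_⊎_; inj₁; inj₂)
open import Data.Vec using ([]; _∷_; updateAt; _∷ʳ_)
open import Data.Vec.Properties using (init-∷ʳ; last-∷ʳ)
open import Function using (_∘_)
open import Relation.Nullary using (yes; no; contradiction)
open import Relation.Binary.PropositionalEquality
  using (_≢_; _≗_; refl; sym; trans; cong; cong₂; subst; ≢-sym; module ≡-Reasoning)

module Counting where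

  open import Data.Nat using (_+_; _*_; _≡ᵇ_)
  open import Data.Nat.Properties
  open import Data.Nat.Tactic.RingSolver using (solve-∀)
  open import Algebra.Properties.CommutativeSemigroup +-commutativeSemigroup
    using (interchange; xy∙z≈xz∙y)
  open import Algebra.Properties.Semiring.Sum +-*-semiring
    using (sum; sum-cong-≗; ∑-distrib-+; *-distribˡ-sum)

  -- Finite sums of natural numbers.

  bit : Bool → ℕ
  bit b = if b then 1 else 0

  bit-∧ : ∀ a b → bit (a ∧ b) ≡ bit a * bit b
  bit-∧ true b = sym (+-identityʳ (bit b))
  bit-∧ false b = refl

  sum-const : ∀ n c → sum {n} (λ _ → c) ≡ n * c
  sum-const zero c = refl
  sum-const (suc n) c = cong (c +_) (sum-const n c)

  sum-mono : ∀ {n} {g h : Fin n → ℕ} → (∀ i → g i ≤ h i) → sum g ≤ sum h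
  sum-mono {zero} g≤h = z≤n
  sum-mono {suc n} g≤h = +-mono-≤ (g≤h zero) (sum-mono (g≤h ∘ suc))

  term≤sum : ∀ {n} (g : Fin n → ℕ) i → g i ≤ sum g
  term≤sum g zero = m≤m+n _ _
  term≤sum g (suc i) = ≤-trans (term≤sum (g ∘ suc) i) (m≤n+m _ _)

  two-terms≤sum : ∀ {n} (g : Fin n → ℕ) {i j} → i ≢ j → g i + g j ≤ sum g
  two-terms≤sum g {zero} {zero} i≢j = contradiction refl i≢j
  two-terms≤sum g {zero} {suc j} i≢j = +-monoʳ-≤ (g zero) (term≤sum (g ∘ suc) j)
  two-terms≤sum g {suc i} {zero} i≢j =
    subst (_≤ sum g) (+-comm (g zero) _) (+-monoʳ-≤ (g zero) (term≤sum (g ∘ suc) i))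
  two-terms≤sum g {suc i} {suc j} i≢j =
    ≤-trans (two-terms≤sum (g ∘ suc) (i≢j ∘ cong suc)) (m≤n+m _ _)

  zero-or-positive-term : ∀ {n} (g : Fin n → ℕ) → sum g ≡ 0 ⊎ ∃ λ i → 1 ≤ g i
  zero-or-positive-term {zero} g = inj₁ refl
  zero-or-positive-term {suc n} g with g zero in eq | zero-or-positive-term (g ∘ suc)
  ... | suc _ | _ = inj₂ (zero , subst (1 ≤_) (sym eq) (s≤s z≤n))
  ... | zero | inj₁ e = inj₁ e
  ... | zero | inj₂ (i , p) = inj₂ (suc i , p)

  -- The entries at (i, j) and (j, i) pair up, so modulo 2 only the diagonal survives; the witness
  -- is the sum of the entries above the diagonal.
  symmetric-sum : ∀ {n} (g : Fin n → Fin n → ℕ) → (∀ i j → g i j ≡ g j i) →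
    ∃ λ k → sum (λ i → sum (g i)) ≡ sum (λ i → g i i) + 2 * k
  symmetric-sum {zero} g g-sym = 0 , refl
  symmetric-sum {suc n} g g-sym = a + k , (begin
    g zero zero + a + sum (λ i → g (suc i) zero + sum (g (suc i) ∘ suc))
      ≡⟨ cong (g zero zero + a +_) (∑-distrib-+ (λ i → g (suc i) zero) _) ⟩
    g zero zero + a + (sum (λ i → g (suc i) zero) + sum (λ i → sum (g (suc i) ∘ suc)))
      ≡⟨ cong₂ (λ u v → g zero zero + a + (u + v)) (sum-cong-≗ (λ i → g-sym (suc i) zero)) eq ⟩
    g zero zero + a + (a + (d + 2 * k))
      ≡⟨ regroup (g zero zero) a d k ⟩
    g zero zero + d + 2 * (a + k) ∎)
    where
    open ≡-Reasoning
    a = sum (g zero ∘ suc)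
    d = sum (λ i → g (suc i) (suc i))
    rest = symmetric-sum (λ i j → g (suc i) (suc j)) (λ i j → g-sym (suc i) (suc j))
    k = proj₁ rest
    eq = proj₂ rest
    regroup : ∀ x a d k → x + a + (a + (d + 2 * k)) ≡ x + d + 2 * (a + k)
    regroup = solve-∀

  -- Sums over all words of a cube.

  sumʷ : ∀ {m} → (Word m → ℕ) → ℕ
  sumʷ {zero} g = g []
  sumʷ {suc m} g = sumʷ (g ∘ (false ∷_)) + sumʷ (g ∘ (true ∷_))

  sumʷ-cong : ∀ {m} {g h : Word m → ℕ} → g ≗ h → sumʷ g ≡ sumʷ h
  sumʷ-cong {zero} e = e []
  sumʷ-cong {suc m} e = cong₂ _+_ (sumʷ-cong (e ∘ (false ∷_))) (sumʷ-cong (e ∘ (true ∷_)))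

  sumʷ-+ : ∀ {m} (g h : Word m → ℕ) → sumʷ (λ x → g x + h x) ≡ sumʷ g + sumʷ h
  sumʷ-+ {zero} g h = refl
  sumʷ-+ {suc m} g h = trans
    (cong₂ _+_ (sumʷ-+ (g ∘ (false ∷_)) _) (sumʷ-+ (g ∘ (true ∷_)) _))
    (interchange (sumʷ (g ∘ (false ∷_))) _ _ _)

  sumʷ-const : ∀ m c → sumʷ {m} (λ _ → c) ≡ 2 ^ m * c
  sumʷ-const zero c = sym (+-identityʳ c)
  sumʷ-const (suc m) c = trans (cong₂ _+_ (sumʷ-const m c) (sumʷ-const m c)) (double (2 ^ m) c)
    where
    double : ∀ a c → a * c + a * c ≡ 2 * a * c
    double = solve-∀

  sumʷ-sum : ∀ {m n} (g : Word m → Fin n → ℕ) →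
    sumʷ (λ x → sum (g x)) ≡ sum (λ i → sumʷ (λ x → g x i))
  sumʷ-sum {zero} g = refl
  sumʷ-sum {suc m} g = trans
    (cong₂ _+_ (sumʷ-sum (g ∘ (false ∷_))) (sumʷ-sum (g ∘ (true ∷_))))
    (sym (∑-distrib-+ (λ i → sumʷ (λ x → g (false ∷ x) i)) _))

  sumʷ-mono : ∀ {m} {g h : Word m → ℕ} → (∀ x → g x ≤ h x) → sumʷ g ≤ sumʷ h
  sumʷ-mono {zero} g≤h = g≤h []
  sumʷ-mono {suc m} g≤h =
    +-mono-≤ (sumʷ-mono (g≤h ∘ (false ∷_))) (sumʷ-mono (g≤h ∘ (true ∷_)))

  +-tightˡ : ∀ {a b c d} → a ≤ c → b ≤ d → a + b ≡ c + d → a ≡ c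
  +-tightˡ {a} {b} {c} {d} a≤c b≤d eq = ≤-antisym a≤c
    (+-cancelʳ-≤ d c a (subst (_≤ a + d) eq (+-monoʳ-≤ a b≤d)))

  +-tightʳ : ∀ {a b c d} → a ≤ c → b ≤ d → a + b ≡ c + d → b ≡ d
  +-tightʳ {a} {b} {c} {d} a≤c b≤d eq =
    +-tightˡ b≤d a≤c (trans (+-comm b a) (trans eq (+-comm c d)))

  -- The equality case of `sumʷ-mono`: slack at one word cannot be made up for elsewhere. This is
  -- how a double count yields information about each single word.
  sumʷ-tight : ∀ {m} {g h : Word m → ℕ} → (∀ x → g x ≤ h x) → sumʷ g ≡ sumʷ h → g ≗ h
  sumʷ-tight {zero} g≤h eq [] = eq
  sumʷ-tight {suc m} g≤h eq (false ∷ x) = sumʷ-tight (g≤h ∘ (false ∷_))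
    (+-tightˡ (sumʷ-mono (g≤h ∘ (false ∷_))) (sumʷ-mono (g≤h ∘ (true ∷_))) eq) x
  sumʷ-tight {suc m} g≤h eq (true ∷ x) = sumʷ-tight (g≤h ∘ (true ∷_))
    (+-tightʳ (sumʷ-mono (g≤h ∘ (false ∷_))) (sumʷ-mono (g≤h ∘ (true ∷_))) eq) x

  -- Bit flips, spheres and balls in the cube.

  flip : ∀ {m} → Fin m → Word m → Word m
  flip i x = updateAt x i not

  flip-involutive : ∀ {m} (i : Fin m) x → flip i (flip i x) ≡ x
  flip-involutive zero (b ∷ x) = cong (_∷ x) (not-involutive b)
  flip-involutive (suc i) (b ∷ x) = cong (b ∷_) (flip-involutive i x)

  flip-comm : ∀ {m} (i j : Fin m) x → flip i (flip j x) ≡ flip j (flip i x)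
  flip-comm zero zero x = refl
  flip-comm zero (suc j) (b ∷ x) = refl
  flip-comm (suc i) zero (b ∷ x) = refl
  flip-comm (suc i) (suc j) (b ∷ x) = cong (b ∷_) (flip-comm i j x)

  sumʷ-flip : ∀ {m} (i : Fin m) (g : Word m → ℕ) → sumʷ (g ∘ flip i) ≡ sumʷ g
  sumʷ-flip zero g = +-comm (sumʷ (g ∘ (true ∷_))) _
  sumʷ-flip (suc i) g = cong₂ _+_ (sumʷ-flip i (g ∘ (false ∷_))) (sumʷ-flip i (g ∘ (true ∷_)))

  -- The ball of radius 1 around x is the set of the words move i x.
  move : ∀ {m} → Fin (suc m) → Word m → Word m
  move zero x = x
  move (suc i) x = flip i x

  move-involutive : ∀ {m} (i : Fin (suc m)) x → move i (move i x) ≡ x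
  move-involutive zero x = refl
  move-involutive (suc i) x = flip-involutive i x

  move-comm : ∀ {m} (i j : Fin (suc m)) x → move i (move j x) ≡ move j (move i x)
  move-comm zero j x = refl
  move-comm (suc i) zero x = refl
  move-comm (suc i) (suc j) x = flip-comm i j x

  sumʷ-move : ∀ {m} (i : Fin (suc m)) (g : Word m → ℕ) → sumʷ (g ∘ move i) ≡ sumʷ g
  sumʷ-move zero g = refl
  sumʷ-move (suc i) g = sumʷ-flip i g

  sphere ball : ∀ {m} → (Word m → ℕ) → Word m → ℕ
  sphere g x = sum (λ i → g (flip i x))
  ball g x = sum (λ i → g (move i x))

  sumʷ-ball : ∀ {m} (g : Word m → ℕ) → sumʷ (ball g) ≡ suc m * sumʷ g
  sumʷ-ball {m} g = begin
    sumʷ (ball g)                    ≡⟨ sumʷ-sum (λ x i → g (move i x)) ⟩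
    sum (λ i → sumʷ (g ∘ move i))    ≡⟨ sum-cong-≗ (λ i → sumʷ-move i g) ⟩
    sum {suc m} (λ _ → sumʷ g)       ≡⟨ sum-const (suc m) (sumʷ g) ⟩
    suc m * sumʷ g                   ∎
    where open ≡-Reasoning

  -- Each `move i` is an involution that permutes the words, so substituting `move i x` for `x`
  -- carries it over from one factor to the other.
  ball-self-adjoint : ∀ {m} (g h : Word m → ℕ) →
    sumʷ (λ x → g x * ball h x) ≡ sumʷ (λ x → h x * ball g x)
  ball-self-adjoint {m} g h = begin
    sumʷ (λ x → g x * ball h x)
      ≡⟨ sumʷ-cong (λ x → *-distribˡ-sum (g x) (λ i → h (move i x))) ⟩
    sumʷ (λ x → sum (λ i → g x * h (move i x)))
      ≡⟨ sumʷ-sum {m} {suc m} (λ x i → g x * h (move i x)) ⟩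
    sum (λ i → sumʷ (λ x → g x * h (move i x)))
      ≡⟨ sum-cong-≗ (λ i → begin
        sumʷ (λ x → g x * h (move i x))
          ≡⟨ sumʷ-move i _ ⟨
        sumʷ (λ x → g (move i x) * h (move i (move i x)))
          ≡⟨ sumʷ-cong (λ x → trans (cong (λ y → g (move i x) * h y) (move-involutive i x))
                                     (*-comm (g (move i x)) (h x))) ⟩
        sumʷ (λ x → h x * g (move i x)) ∎) ⟩
    sum (λ i → sumʷ (λ x → h x * g (move i x)))
      ≡⟨ sumʷ-sum {m} {suc m} (λ x i → h x * g (move i x)) ⟨
    sumʷ (λ x → sum (λ i → h x * g (move i x)))
      ≡⟨ sumʷ-cong (λ x → *-distribˡ-sum (h x) (λ i → g (move i x))) ⟨
    sumʷ (λ x → h x * ball g x) ∎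
    where open ≡-Reasoning

  ball-cong : ∀ {m} {g h : Word m → ℕ} → g ≗ h → ball g ≗ ball h
  ball-cong e x = sum-cong-≗ (λ i → e (move i x))

  ball-suc : ∀ {m} (g : Word m → ℕ) x → ball (suc ∘ g) x ≡ suc m + ball g x
  ball-suc {m} g x = trans (∑-distrib-+ {suc m} (λ _ → 1) (λ i → g (move i x)))
    (cong (_+ ball g x) (trans (sum-const (suc m) 1) (*-identityʳ (suc m))))

  -- Moves commute, so the double sum is symmetric in its two indices; moves are involutions, so
  -- every diagonal term is `g x`. Hence only the diagonal counts modulo 2.
  ball-ball : ∀ {m} (g : Word m → ℕ) x → ∃ λ k → ball (ball g) x ≡ suc m * g x + 2 * k
  ball-ball {m} g x = proj₁ s , (begin
    ball (ball g) x
      ≡⟨ proj₂ s ⟩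
    sum (λ i → g (move i (move i x))) + 2 * proj₁ s
      ≡⟨ cong (_+ 2 * proj₁ s) (sum-cong-≗ (λ i → cong g (move-involutive i x))) ⟩
    sum {suc m} (λ _ → g x) + 2 * proj₁ s
      ≡⟨ cong (_+ 2 * proj₁ s) (sum-const (suc m) (g x)) ⟩
    suc m * g x + 2 * proj₁ s ∎)
    where
    open ≡-Reasoning
    s = symmetric-sum (λ i j → g (move j (move i x))) (λ i j → cong g (move-comm j i x))

  -- The size hypothesis says that the balls cover every word on average 1 + 1/m times.
  module NearlyPerfect {m} (C : Code m) (h : ℕ) (m-even : m ≡ 2 * h)
    (size : 2 ^ m ≡ m * sumʷ (bit ∘ C)) (covering : ∀ x → 1 ≤ ball (bit ∘ C) x) where

    -- The excess of the covering and its ball sums.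

    f f′ excess : Word m → ℕ
    f = bit ∘ C
    f′ = bit ∘ not ∘ C
    excess x = ball f x ∸ 1

    f+f′ : ∀ x → f x + f′ x ≡ 1
    f+f′ x with C x
    ... | true = refl
    ... | false = refl

    ball-f : ∀ x → ball f x ≡ suc (excess x)
    ball-f x = sym (m+[n∸m]≡n (covering x))

    -- The balls around codewords have total size (m + 1)|C|, and covering each word once uses up
    -- 2^m = m|C| of it.
    sum-excess : sumʷ excess ≡ sumʷ f
    sum-excess = +-cancelˡ-≡ (2 ^ m) _ _ (begin
      2 ^ m + sumʷ excess            ≡⟨ cong (_+ sumʷ excess) (trans (sym (*-identityʳ (2 ^ m))) (sym (sumʷ-const m 1))) ⟩
      sumʷ {m} (λ _ → 1) + sumʷ excess ≡⟨ sumʷ-+ {m} (λ _ → 1) excess ⟨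
      sumʷ (λ x → suc (excess x))            ≡⟨ sumʷ-cong ball-f ⟨
      sumʷ (ball f)                  ≡⟨ sumʷ-ball f ⟩
      sumʷ f + m * sumʷ f            ≡⟨ +-comm (sumʷ f) _ ⟩
      m * sumʷ f + sumʷ f            ≡⟨ cong (_+ sumʷ f) size ⟨
      2 ^ m + sumʷ f ∎)
      where open ≡-Reasoning

    ball-excess : ∀ x → ∃ λ k → suc m + ball excess x ≡ suc m * f x + 2 * k
    ball-excess x with ball-ball f x
    ... | k , eq = k , trans (sym (trans (ball-cong ball-f x) (ball-suc excess x))) eq

    -- Off the code, `ball-excess` makes m + 1 + `ball excess x` even. As m + 1 is odd, the ball sum
    -- is odd and so not zero.
    ball-excess-off : ∀ x → f x ≡ 0 → 1 ≤ ball excess x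
    ball-excess-off x fx≡0 with ball excess x | ball-excess x
    ... | suc _ | _ = s≤s z≤n
    ... | zero | k , eq = contradiction (begin
      suc (2 * h)               ≡⟨ cong suc m-even ⟨
      suc m                     ≡⟨ +-identityʳ _ ⟨
      suc m + 0                 ≡⟨ eq ⟩
      suc m * f x + 2 * k       ≡⟨ cong (λ u → suc m * u + 2 * k) fx≡0 ⟩
      suc m * 0 + 2 * k         ≡⟨ cong (_+ 2 * k) (*-zeroʳ (suc m)) ⟩
      2 * k ∎) (≢-sym (even≢odd k h))
      where open ≡-Reasoning

    -- Self-adjointness moves the ball operator onto `f`, where it is known to give 1 + `excess`.
    sum-f*ball : sumʷ (λ x → f x * ball excess x) ≡ sumʷ excess + sumʷ (λ x → excess x * excess x)
    sum-f*ball = begin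
      sumʷ (λ x → f x * ball excess x)
        ≡⟨ ball-self-adjoint f excess ⟩
      sumʷ (λ x → excess x * ball f x)
        ≡⟨ sumʷ-cong (λ x → trans (cong (excess x *_) (ball-f x)) (*-suc (excess x) (excess x))) ⟩
      sumʷ (λ x → excess x + excess x * excess x)
        ≡⟨ sumʷ-+ excess _ ⟩
      sumʷ excess + sumʷ (λ x → excess x * excess x) ∎
      where open ≡-Reasoning

    excess≤excess² : ∀ x → excess x ≤ excess x * excess x
    excess≤excess² x with excess x
    ... | zero = z≤n
    ... | suc e = m≤m*n (suc e) (suc e)

    off-bound : ∀ x → 1 ≤ f′ x * ball excess x + f x
    off-bound x = by-value (C x) (ball-excess-off x)
      where
      by-value : ∀ b {n} → (bit b ≡ 0 → 1 ≤ n) → 1 ≤ bit (not b) * n + bit b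
      by-value true 1≤n = ≤-refl
      by-value false 1≤n = ≤-trans (≤-trans (1≤n refl) (m≤m+n _ 0)) (m≤m+n _ 0)

    -- The two sides are the totals of the two sides of `off-bound` and `excess≤excess²` added
    -- together, so neither inequality has slack at any word. The equality comes from counting
    -- `ball excess` in total and subtracting its part on the code, which `sum-f*ball` supplies.
    off-sum : sumʷ (λ x → 1 + excess x) ≡
      sumʷ (λ x → f′ x * ball excess x + f x + excess x * excess x)
    -- Adding the total excess to both sides avoids subtraction and lets `sum-excess` exchange the
    -- totals of `f` and `excess`.
    off-sum = +-cancelʳ-≡ (sumʷ excess) _ _ (begin
      sumʷ (λ x → 1 + excess x) + sumʷ excess
        ≡⟨ cong (_+ sumʷ excess) (trans (sym (sumʷ-cong ball-f)) (sumʷ-ball f)) ⟩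
      suc m * sumʷ f + sumʷ excess
        ≡⟨ cong₂ (λ u v → suc m * u + v) (sym sum-excess) sum-excess ⟩
      suc m * sumʷ excess + sumʷ f
        ≡⟨ cong (_+ sumʷ f) (trans (sym (sumʷ-ball excess))
             (trans (sumʷ-cong split) (sumʷ-+ (λ x → f x * ball excess x) _))) ⟩
      sumʷ (λ x → f x * ball excess x) + a + sumʷ f
        ≡⟨ cong (λ u → u + a + sumʷ f) sum-f*ball ⟩
      sumʷ excess + e² + a + sumʷ f
        ≡⟨ regroup (sumʷ excess) e² a (sumʷ f) ⟩
      a + sumʷ f + e² + sumʷ excess
        ≡⟨ cong (_+ sumʷ excess)
            (trans (sumʷ-+ (λ x → f′ x * ball excess x + f x) _)
                   (cong (_+ e²) (sumʷ-+ (λ x → f′ x * ball excess x) f))) ⟨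
      sumʷ (λ x → f′ x * ball excess x + f x + excess x * excess x) + sumʷ excess ∎)
      where
      open ≡-Reasoning
      a = sumʷ (λ x → f′ x * ball excess x)
      e² = sumʷ (λ x → excess x * excess x)
      split : ∀ x → ball excess x ≡ f x * ball excess x + f′ x * ball excess x
      split x = trans (sym (*-identityˡ _))
        (trans (cong (_* ball excess x) (sym (f+f′ x))) (*-distribʳ-+ (ball excess x) (f x) (f′ x)))
      regroup : ∀ e s a f → e + s + a + f ≡ a + f + s + e
      regroup = solve-∀

    off-tight : ∀ x → 1 + excess x ≡ f′ x * ball excess x + f x + excess x * excess x
    off-tight = sumʷ-tight (λ x → +-mono-≤ (off-bound x) (excess≤excess² x)) off-sum

    excess≡excess² : ∀ x → excess x ≡ excess x * excess x
    excess≡excess² x = +-tightʳ (off-bound x) (excess≤excess² x) (off-tight x)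

    excess≤1 : ∀ x → excess x ≤ 1
    excess≤1 x with excess x | excess≡excess² x
    ... | zero | _ = z≤n
    ... | suc zero | _ = ≤-refl
    ... | suc (suc e) | eq = contradiction
      (*-cancelʳ-≡ 1 (suc (suc e)) (suc (suc e)) (trans (+-identityʳ _) eq)) λ ()

    ball-excess-off≡1 : ∀ x → C x ≡ false → ball excess x ≡ 1
    ball-excess-off≡1 x eq =
      by-value (C x) eq (+-tightˡ (off-bound x) (excess≤excess² x) (off-tight x))
      where
      by-value : ∀ b {n} → b ≡ false → 1 ≡ bit (not b) * n + bit b → n ≡ 1
      by-value false refl e = sym (trans e (trans (+-identityʳ _) (+-identityʳ _)))

    -- If two words of positive excess in the ball around a codeword x are move i x and move k x,
    -- then move k (move i x) is a codeword, because a non-codeword sees only one positive excess.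
    -- So the two codewords around move i x dominate all of the excess around x.
    ball-excess-on≤2 : ∀ x → C x ≡ true → ball excess x ≤ 2
    ball-excess-on≤2 x Cx with zero-or-positive-term (λ i → excess (move i x))
    ... | inj₁ eq = subst (_≤ 2) (sym eq) z≤n
    ... | inj₂ (i , p) = ≤-trans (sum-mono dominated)
        (subst (_≤ 2) (sym (ball-f (move i x))) (s≤s (excess≤1 (move i x))))
      where
      dominated : ∀ k → excess (move k x) ≤ f (move k (move i x))
      dominated k with C (move k (move i x)) in eq
      ... | true = excess≤1 (move k x)
      ... | false with k Fin.≟ i
      ...   | yes refl = contradiction
        (trans (sym eq) (trans (cong C (move-involutive i x)) Cx)) λ ()
      -- Here `y` is not a codeword, so its ball holds total excess 1; but it contains both
      -- `move i x`, of positive excess, and `move k x`.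
      ...   | no k≢i = ≤-pred (begin
        suc (excess (move k x))          ≤⟨ +-monoˡ-≤ (excess (move k x)) p ⟩
        excess (move i x) + excess (move k x)
          ≡⟨ cong₂ (λ u v → excess u + excess v) back-k back-i ⟩
        excess (move k y) + excess (move i y)
          ≤⟨ two-terms≤sum (λ j → excess (move j y)) k≢i ⟩
        ball excess y                    ≡⟨ ball-excess-off≡1 y eq ⟩
        1 ∎)
        where
        open ≤-Reasoning
        y = move k (move i x)
        back-k : move i x ≡ move k y
        back-k = sym (move-involutive k (move i x))
        back-i : move k x ≡ move i y
        back-i = sym (trans (cong (move i) (move-comm k i x)) (move-involutive i (move k x)))

    on-bound : ∀ x → f x * ball excess x ≤ 2 * f x
    on-bound x = by-value (C x) (ball-excess-on≤2 x)
      where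
      by-value : ∀ b {n} → (b ≡ true → n ≤ 2) → bit b * n ≤ 2 * bit b
      by-value true n≤2 = ≤-trans (≤-reflexive (+-identityʳ _)) (n≤2 refl)
      by-value false n≤2 = z≤n

    -- With `excess` equal to its square, `sum-f*ball` gives twice the total excess, which is 2|C|:
    -- the bound 2 is attained on average, hence at every codeword.
    on-tight : ∀ x → f x * ball excess x ≡ 2 * f x
    on-tight = sumʷ-tight on-bound (begin
      sumʷ (λ x → f x * ball excess x)      ≡⟨ sum-f*ball ⟩
      sumʷ excess + sumʷ (λ x → excess x * excess x)
        ≡⟨ cong (sumʷ excess +_) (sumʷ-cong excess≡excess²) ⟨
      sumʷ excess + sumʷ excess             ≡⟨ cong₂ _+_ sum-excess sum-excess ⟩
      sumʷ f + sumʷ f                       ≡⟨ sumʷ-+ f f ⟨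
      sumʷ (λ x → f x + f x)                ≡⟨ sumʷ-cong (λ x → cong (f x +_) (sym (+-identityʳ (f x)))) ⟩
      sumʷ (λ x → 2 * f x) ∎)
      where open ≡-Reasoning

    -- The mirror image of `ball-f`: taking ball sums and subtracting 1 interchanges `f` and
    -- `excess`.
    ball-excess≡ : ∀ x → ball excess x ≡ suc (f x)
    ball-excess≡ x = by-value (C x) (ball-excess-off≡1 x) (on-tight x)
      where
      by-value : ∀ b {n} → (b ≡ false → n ≡ 1) → bit b * n ≡ 2 * bit b → n ≡ suc (bit b)
      by-value false off on = off refl
      by-value true off on = trans (sym (+-identityʳ _)) on

  -- Weight distributions as layer sums.

  countB-++ : ∀ {X : Set} (p : X → Bool) xs ys → countB p (xs ++ ys) ≡ countB p xs + countB p ys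
  countB-++ p [] ys = refl
  countB-++ p (x ∷ xs) ys = trans (cong (bit (p x) +_) (countB-++ p xs ys)) (sym (+-assoc (bit (p x)) _ _))

  countB-map : ∀ {X Y : Set} (p : Y → Bool) (g : X → Y) xs → countB p (map g xs) ≡ countB (p ∘ g) xs
  countB-map p g [] = refl
  countB-map p g (x ∷ xs) = cong (bit (p (g x)) +_) (countB-map p g xs)

  countB-words : ∀ {m} (p : Word (suc m) → Bool) → countB p (allWords (suc m)) ≡
    countB (p ∘ (false ∷_)) (allWords m) + countB (p ∘ (true ∷_)) (allWords m)
  countB-words {m} p = trans (countB-++ p (map (false ∷_) (allWords m)) _)
    (cong₂ _+_ (countB-map p (false ∷_) (allWords m)) (countB-map p (true ∷_) (allWords m)))

  card≡sumʷ : ∀ {m} (C : Code m) → card C ≡ sumʷ (bit ∘ C)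
  card≡sumʷ {zero} C = +-identityʳ _
  card≡sumʷ {suc m} C = trans (countB-words C) (cong₂ _+_ (card≡sumʷ (C ∘ (false ∷_))) (card≡sumʷ (C ∘ (true ∷_))))

  -- The sum over the words of weight i, given by a Pascal recursion on the first bit so that
  -- inductions on the length run parallel to those for binomial coefficients.
  layer : ∀ {m} → (Word m → ℕ) → ℕ → ℕ
  layer {zero} g zero = g []
  layer {zero} g (suc i) = 0
  layer {suc m} g zero = layer (g ∘ (false ∷_)) 0
  layer {suc m} g (suc i) = layer (g ∘ (false ∷_)) (suc i) + layer (g ∘ (true ∷_)) i

  countB-false : ∀ {X : Set} {p : X → Bool} → (∀ x → p x ≡ false) → ∀ xs → countB p xs ≡ 0
  countB-false e [] = refl
  countB-false e (x ∷ xs) = cong₂ _+_ (cong bit (e x)) (countB-false e xs)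

  A≡layer : ∀ {m} (C : Code m) i → A C i ≡ layer (bit ∘ C) i
  A≡layer {zero} C zero with C []
  ... | true = refl
  ... | false = refl
  A≡layer {zero} C (suc i) with C []
  ... | true = refl
  ... | false = refl
  A≡layer {suc m} C zero = trans (countB-words (λ w → C w ∧ (weight w ≡ᵇ 0)))
    (trans (cong₂ _+_ (A≡layer (C ∘ (false ∷_)) 0) (countB-false (λ x → ∧-zeroʳ (C (true ∷ x))) (allWords m)))
           (+-identityʳ _))
  A≡layer {suc m} C (suc i) = trans (countB-words (λ w → C w ∧ (weight w ≡ᵇ suc i)))
    (cong₂ _+_ (A≡layer (C ∘ (false ∷_)) (suc i)) (A≡layer (C ∘ (true ∷_)) i))

  layer-cong-weight : ∀ {m} {g h : Word m → ℕ} i → (∀ x → weight x ≡ i → g x ≡ h x) → layer g i ≡ layer h i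
  layer-cong-weight {zero} zero e = e [] refl
  layer-cong-weight {zero} (suc i) e = refl
  layer-cong-weight {suc m} zero e = layer-cong-weight 0 (λ x → e (false ∷ x))
  layer-cong-weight {suc m} (suc i) e = cong₂ _+_
    (layer-cong-weight (suc i) (λ x → e (false ∷ x)))
    (layer-cong-weight i (λ x wt → e (true ∷ x) (cong suc wt)))

  layer-cong : ∀ {m} {g h : Word m → ℕ} → g ≗ h → ∀ i → layer g i ≡ layer h i
  layer-cong e i = layer-cong-weight i (λ x _ → e x)

  layer-+ : ∀ {m} (g h : Word m → ℕ) i → layer (λ x → g x + h x) i ≡ layer g i + layer h i
  layer-+ {zero} g h zero = refl
  layer-+ {zero} g h (suc i) = refl
  layer-+ {suc m} g h zero = layer-+ (g ∘ (false ∷_)) _ 0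
  layer-+ {suc m} g h (suc i) = trans
    (cong₂ _+_ (layer-+ (g ∘ (false ∷_)) _ (suc i)) (layer-+ (g ∘ (true ∷_)) _ i))
    (interchange (layer (g ∘ (false ∷_)) (suc i)) _ _ _)

  layer-zero : ∀ m i → layer {m} (λ _ → 0) i ≡ 0
  layer-zero zero zero = refl
  layer-zero zero (suc i) = refl
  layer-zero (suc m) zero = layer-zero m 0
  layer-zero (suc m) (suc i) = cong₂ _+_ (layer-zero m (suc i)) (layer-zero m i)

  layer-one : ∀ m i → layer {m} (λ _ → 1) i ≡ binom m i
  layer-one zero zero = refl
  layer-one zero (suc i) = refl
  layer-one (suc m) zero = layer-one m 0
  layer-one (suc m) (suc i) = trans (cong₂ _+_ (layer-one m (suc i)) (layer-one m i))
    (trans (+-comm (binom m (suc i)) _) (nCk+nC[k+1]≡[n+1]C[k+1] m i))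

  layer-at-zero : ∀ {m} (g : Word m → ℕ) → layer g 0 ≡ g (zeroWord m)
  layer-at-zero {zero} g = refl
  layer-at-zero {suc m} g = layer-at-zero (g ∘ (false ∷_))

  -- `extend` puts the check bit last, whereas `layer` and `flip` peel off the first bit. A cyclic
  -- shift brings the check bit to the front without changing weights.
  rotate : ∀ {m} → Word (suc m) → Word (suc m)
  rotate (b ∷ x) = x ∷ʳ b

  layer-rotate : ∀ {m} (g : Word (suc m) → ℕ) i → layer (g ∘ rotate) i ≡ layer g i
  layer-rotate {zero} g zero = refl
  layer-rotate {zero} g (suc zero) = refl
  layer-rotate {zero} g (suc (suc i)) = refl
  layer-rotate {suc m} g zero = layer-rotate (g ∘ (false ∷_)) 0
  -- The induction exchanges the first two bits. A word of weight 1 cannot start with two ones, so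
  -- three terms are permuted here and four in the next clause.
  layer-rotate {suc m} g (suc zero) = trans (xy∙z≈xz∙y (layer (λ x → g (false ∷ (x ∷ʳ false))) 1) _ _)
    (cong₂ _+_ (layer-rotate (g ∘ (false ∷_)) 1) (layer-rotate (g ∘ (true ∷_)) 0))
  layer-rotate {suc m} g (suc (suc i)) = trans (interchange (layer (λ x → g (false ∷ (x ∷ʳ false))) (2 + i)) _ _ _)
    (cong₂ _+_ (layer-rotate (g ∘ (false ∷_)) (2 + i)) (layer-rotate (g ∘ (true ∷_)) (suc i)))

  -- Sphere sums layer by layer.

  layer-sphere-zero : ∀ {m} (g : Word m → ℕ) → layer (sphere g) 0 ≡ layer g 1
  layer-sphere-zero {zero} g = refl
  layer-sphere-zero {suc m} g = begin
    layer (λ x → g (true ∷ x) + sphere (g ∘ (false ∷_)) x) 0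
      ≡⟨ layer-+ (g ∘ (true ∷_)) _ 0 ⟩
    layer (g ∘ (true ∷_)) 0 + layer (sphere (g ∘ (false ∷_))) 0
      ≡⟨ cong (layer (g ∘ (true ∷_)) 0 +_) (layer-sphere-zero (g ∘ (false ∷_))) ⟩
    layer (g ∘ (true ∷_)) 0 + layer (g ∘ (false ∷_)) 1
      ≡⟨ +-comm (layer (g ∘ (true ∷_)) 0) _ ⟩
    layer (g ∘ (false ∷_)) 1 + layer (g ∘ (true ∷_)) 0 ∎
    where open ≡-Reasoning

  -- A word of weight i has i neighbours of weight i - 1 and m - i of weight i + 1.
  layer-sphere-suc : ∀ {m} (g : Word m → ℕ) i →
    layer (sphere g) (suc i) + i * layer g i ≡ m * layer g i + (2 + i) * layer g (2 + i)
  layer-sphere-suc {zero} g zero = refl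
  layer-sphere-suc {zero} g (suc i) = refl
  layer-sphere-suc {suc m} g zero = begin
    -- Flipping the first bit leads into the other half of the cube; all other flips stay within the
    -- same half, where induction applies.
    layer (λ x → g₁ x + sphere g₀ x) 1 + layer (λ x → g₀ x + sphere g₁ x) 0 + 0
      ≡⟨ cong₂ (λ u v → u + v + 0) (layer-+ g₁ _ 1) (layer-+ g₀ _ 0) ⟩
    layer g₁ 1 + layer (sphere g₀) 1 + (layer g₀ 0 + layer (sphere g₁) 0) + 0
      ≡⟨ cong₂ (λ u v → layer g₁ 1 + u + (layer g₀ 0 + v) + 0)
           (trans (sym (+-identityʳ _)) (layer-sphere-suc g₀ 0)) (layer-sphere-zero g₁) ⟩
    layer g₁ 1 + (m * layer g₀ 0 + 2 * layer g₀ 2) + (layer g₀ 0 + layer g₁ 1) + 0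
      ≡⟨ regroup m (layer g₁ 1) (layer g₀ 0) (layer g₀ 2) ⟩
    suc m * layer g₀ 0 + 2 * (layer g₀ 2 + layer g₁ 1) ∎
    where
    open ≡-Reasoning
    g₀ = g ∘ (false ∷_)
    g₁ = g ∘ (true ∷_)
    regroup : ∀ m a b c → a + (m * b + 2 * c) + (b + a) + 0 ≡ (1 + m) * b + 2 * (c + a)
    regroup = solve-∀
  layer-sphere-suc {suc m} g (suc i) = begin
    layer (λ x → g₁ x + sphere g₀ x) (2 + i) + layer (λ x → g₀ x + sphere g₁ x) (1 + i) + (1 + i) * (a₁ + b₀)
      ≡⟨ cong₂ (λ u v → u + v + (1 + i) * (a₁ + b₀)) (layer-+ g₁ _ (2 + i)) (layer-+ g₀ _ (1 + i)) ⟩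
    b₂ + layer (sphere g₀) (2 + i) + (a₁ + layer (sphere g₁) (1 + i)) + (1 + i) * (a₁ + b₀)
      ≡⟨ regroup₁ i b₂ (layer (sphere g₀) (2 + i)) a₁ (layer (sphere g₁) (1 + i)) b₀ ⟩
    b₂ + a₁ + b₀ + (layer (sphere g₀) (2 + i) + (1 + i) * a₁) + (layer (sphere g₁) (1 + i) + i * b₀)
      ≡⟨ cong₂ (λ u v → b₂ + a₁ + b₀ + u + v) (layer-sphere-suc g₀ (suc i)) (layer-sphere-suc g₁ i) ⟩
    b₂ + a₁ + b₀ + (m * a₁ + (3 + i) * a₃) + (m * b₀ + (2 + i) * b₂)
      ≡⟨ regroup₂ m i b₂ a₁ b₀ a₃ ⟩
    (1 + m) * (a₁ + b₀) + (3 + i) * (a₃ + b₂) ∎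
    where
    open ≡-Reasoning
    g₀ = g ∘ (false ∷_)
    g₁ = g ∘ (true ∷_)
    a₁ = layer g₀ (1 + i)
    a₃ = layer g₀ (3 + i)
    b₀ = layer g₁ i
    b₂ = layer g₁ (2 + i)
    regroup₁ : ∀ i b₂ s a₁ t b₀ → b₂ + s + (a₁ + t) + (1 + i) * (a₁ + b₀) ≡
      b₂ + a₁ + b₀ + (s + (1 + i) * a₁) + (t + i * b₀)
    regroup₁ = solve-∀
    regroup₂ : ∀ m i b₂ a₁ b₀ a₃ → b₂ + a₁ + b₀ + (m * a₁ + (3 + i) * a₃) + (m * b₀ + (2 + i) * b₂) ≡
      (1 + m) * (a₁ + b₀) + (3 + i) * (a₃ + b₂)
    regroup₂ = solve-∀

  -- Parity and the extended code.

  oddᵇ : ℕ → Bool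
  oddᵇ zero = false
  oddᵇ (suc i) = not (oddᵇ i)

  parity-weight : ∀ {m} (x : Word m) → parity x ≡ oddᵇ (weight x)
  parity-weight [] = refl
  parity-weight (true ∷ x) = cong not (parity-weight x)
  parity-weight (false ∷ x) = parity-weight x

  parity-flip : ∀ {m} (i : Fin m) x → parity (flip i x) ≡ not (parity x)
  parity-flip zero (b ∷ x) = sym (not-distribˡ-xor b (parity x))
  parity-flip (suc i) (b ∷ x) = trans (cong (b xor_) (parity-flip i x)) (sym (not-distribʳ-xor b (parity x)))

  layer-cong-parity : ∀ {m} {g h : Word m → ℕ} i → (∀ x → parity x ≡ oddᵇ i → g x ≡ h x) → layer g i ≡ layer h i
  layer-cong-parity i e = layer-cong-weight i (λ x wt → e x (trans (parity-weight x) (cong oddᵇ wt)))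

  -- Restates the equality test local to `extend` as a negated xor, the form in which `lift` also
  -- compares the check bit.
  extend-∷ʳ : ∀ {m} (C : Code m) β x b → extend C β (x ∷ʳ b) ≡ C x ∧ not (b xor (β xor parity x))
  extend-∷ʳ C β x b rewrite init-∷ʳ b x | last-∷ʳ b x with b | β xor parity x
  ... | true | true = refl
  ... | true | false = refl
  ... | false | true = refl
  ... | false | false = refl

  module Lift {m} (f e : Word m → ℕ) (ball-f : ∀ x → ball f x ≡ suc (e x))
    (ball-e : ∀ x → ball e x ≡ suc (f x)) (β : Bool) where

    choose : Bool → Word m → ℕ
    choose b x = if b then e x else f x

    -- The selector is false exactly when the whole word `b ∷ x` has parity `β`; such words carry
    -- `f` and the others `e`.
    lift : Word (suc m) → ℕ
    lift (b ∷ x) = choose (b xor (β xor parity x)) x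

    ball-choose : ∀ b x → ball (choose b) x ≡ suc (choose (not b) x)
    ball-choose true x = ball-e x
    ball-choose false x = ball-f x

    -- Deleting the first bit maps the sphere around `b ∷ x` bijectively onto the ball around `x`:
    -- flipping the check bit fixes `x`, and any other flip moves it. Each flip changes the parity,
    -- hence exchanges `f` and `e`, so the two ball identities merge into one.
    sphere-lift : ∀ w → sphere lift w ≡ suc (lift w)
    sphere-lift (b ∷ x) = begin
      choose (not b xor q) x + sum (λ i → choose (b xor (β xor parity (flip i x))) (flip i x))
        ≡⟨ cong₂ _+_ (cong (λ c → choose c x) (sym (not-distribˡ-xor b q)))
                     (sum-cong-≗ (λ i → cong (λ c → choose c (flip i x)) (flipped i))) ⟩
      ball (choose (not (b xor q))) x
        ≡⟨ ball-choose (not (b xor q)) x ⟩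
      suc (choose (not (not (b xor q))) x)
        ≡⟨ cong (λ c → suc (choose c x)) (not-involutive (b xor q)) ⟩
      suc (choose (b xor q) x) ∎
      where
      open ≡-Reasoning
      q = β xor parity x
      flipped : ∀ i → b xor (β xor parity (flip i x)) ≡ not (b xor q)
      flipped i = trans (cong (λ p → b xor (β xor p)) (parity-flip i x))
        (trans (cong (b xor_) (sym (not-distribʳ-xor β (parity x)))) (sym (not-distribʳ-xor b q)))

  module Extended {m} (C : Code m) (e : Word m → ℕ)
    (ball-f : ∀ x → ball (bit ∘ C) x ≡ suc (e x)) (ball-e : ∀ x → ball e x ≡ suc (bit (C x)))
    (β : Bool) (Cs : Code (suc m)) (Cs-def : ∀ w → Cs w ≡ extend C β w) where

    open Lift (bit ∘ C) e ball-f ball-e β public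

    A≡layer-rotate : ∀ i → A Cs i ≡ layer (bit ∘ Cs ∘ rotate) i
    A≡layer-rotate i = trans (A≡layer Cs i) (sym (layer-rotate (bit ∘ Cs) i))

    rotate-Cs : ∀ b x → Cs (rotate (b ∷ x)) ≡ C x ∧ not (b xor (β xor parity x))
    rotate-Cs b x = trans (Cs-def (x ∷ʳ b)) (extend-∷ʳ C β x b)

    xor-swap : ∀ a b c d → a xor c ≡ d → a xor (b xor c) ≡ b xor d
    xor-swap true true c d e = cong not e
    xor-swap true false c d e = e
    xor-swap false true c d e = cong not e
    xor-swap false false c d e = e

    -- On words of parity `β` the check bit is correct, so membership in `Cs` is membership of `x`
    -- in `C`, and `lift` is `f` there too.
    A≡layer-lift : ∀ i → oddᵇ i ≡ β → A Cs i ≡ layer lift i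
    A≡layer-lift i eq = trans (A≡layer-rotate i) (layer-cong-parity i agree)
      where
      by-value : ∀ q x → q ≡ false → bit (C x ∧ not q) ≡ choose q x
      by-value .false x refl = trans (bit-∧ (C x) true) (*-identityʳ _)
      agree : ∀ w → parity w ≡ oddᵇ i → bit (Cs (rotate w)) ≡ lift w
      agree (b ∷ x) p = trans (cong bit (rotate-Cs b x))
        (by-value _ x (trans (xor-swap b β (parity x) β (trans p eq)) (xor-same β)))

    -- In a word of the opposite parity the check bit is wrong.
    A≡0 : ∀ i → oddᵇ i ≡ not β → A Cs i ≡ 0
    A≡0 i eq = trans (A≡layer-rotate i) (trans (layer-cong-parity i vanish) (layer-zero (suc m) i))
      where
      by-value : ∀ q x → q ≡ true → bit (C x ∧ not q) ≡ 0
      by-value .true x refl = cong bit (∧-zeroʳ (C x))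
      vanish : ∀ w → parity w ≡ oddᵇ i → bit (Cs (rotate w)) ≡ 0
      vanish (b ∷ x) p = trans (cong bit (rotate-Cs b x))
        (by-value _ x (trans (xor-swap b β (parity x) (not β) (trans p eq)) (xor-inverseʳ β)))

    layer-lift-one : layer lift 1 ≡ suc (layer lift 0)
    layer-lift-one = trans (sym (layer-sphere-zero lift)) (trans (layer-cong sphere-lift 0)
      (trans (layer-+ {suc m} (λ _ → 1) lift 0) (cong (_+ layer lift 0) (layer-one (suc m) 0))))

    layer-lift-rec : ∀ i → (2 + i) * layer lift (2 + i) + suc m * layer lift i ≡
      binom (suc m) (suc i) + layer lift (suc i) + i * layer lift i
    layer-lift-rec i = begin
      (2 + i) * layer lift (2 + i) + suc m * layer lift i
        ≡⟨ +-comm _ (suc m * layer lift i) ⟩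
      suc m * layer lift i + (2 + i) * layer lift (2 + i)
        ≡⟨ layer-sphere-suc lift i ⟨
      layer (sphere lift) (suc i) + i * layer lift i
        ≡⟨ cong (_+ i * layer lift i) (trans (layer-cong sphere-lift (suc i))
             (trans (layer-+ {suc m} (λ _ → 1) lift (suc i)) (cong (_+ layer lift (suc i)) (layer-one (suc m) (suc i))))) ⟩
      binom (suc m) (suc i) + layer lift (suc i) + i * layer lift i ∎
      where open ≡-Reasoning

  -- From Hamming distance to balls.

  dist-zero : ∀ {m} (x c : Word m) → dist x c ≤ 0 → x ≡ c
  dist-zero [] [] _ = refl
  dist-zero (true ∷ x) (true ∷ c) d = cong (true ∷_) (dist-zero x c d)
  dist-zero (false ∷ x) (false ∷ c) d = cong (false ∷_) (dist-zero x c d)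
  dist-zero (true ∷ x) (false ∷ c) ()
  dist-zero (false ∷ x) (true ∷ c) ()

  dist≤1⇒move : ∀ {m} (x c : Word m) → dist x c ≤ 1 → ∃ λ i → move i x ≡ c
  dist≤1⇒move [] [] _ = zero , refl
  dist≤1⇒move (true ∷ x) (false ∷ c) (s≤s d) = suc zero , cong (false ∷_) (dist-zero x c d)
  dist≤1⇒move (false ∷ x) (true ∷ c) (s≤s d) = suc zero , cong (true ∷_) (dist-zero x c d)
  dist≤1⇒move (true ∷ x) (true ∷ c) d with dist≤1⇒move x c d
  ... | zero , eq = zero , cong (true ∷_) eq
  ... | suc i , eq = suc (suc i) , cong (true ∷_) eq
  dist≤1⇒move (false ∷ x) (false ∷ c) d with dist≤1⇒move x c d
  ... | zero , eq = zero , cong (false ∷_) eq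
  ... | suc i , eq = suc (suc i) , cong (false ∷_) eq

  covering⇒ball : ∀ {m} (C : Code m) →
    (∀ x → Σ (Word m) λ c → (C c ≡ true) × (dist x c ≤ 1)) → ∀ x → 1 ≤ ball (bit ∘ C) x
  covering⇒ball C cov x with cov x
  ... | c , Cc , d with dist≤1⇒move x c d
  ... | i , refl = subst (_≤ ball (bit ∘ C) x) (cong bit Cc) (term≤sum (λ j → bit (C (move j x))) i)

open Counting
open import Data.Integer using (ℤ; +_; _+_; _-_; _*_)
open import Data.Integer using (-_; 1ℤ; -1ℤ)
open import Data.Integer.Properties
  using (pos-+; pos-*; *-cancelˡ-≡; *-identityˡ; *-identityʳ; -1*i≡-i; neg-involutive; +-comm)
open import Data.Integer.Tactic.RingSolver using (solve-∀)

-- Binomial identities and alternating signs.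

binom-absorb : ∀ n k → suc k ℕ.* binom n (suc k) ℕ.+ k ℕ.* binom n k ≡ n ℕ.* binom n k
binom-absorb zero zero = refl
binom-absorb zero (suc k) = cong₂ ℕ._+_ (ℕ.*-zeroʳ (suc (suc k))) (ℕ.*-zeroʳ (suc k))
binom-absorb (suc n) zero = begin
  1 ℕ.* binom (suc n) 1 ℕ.+ 0
    ≡⟨ cong (λ u → 1 ℕ.* u ℕ.+ 0) (nCk+nC[k+1]≡[n+1]C[k+1] n 0) ⟨
  1 ℕ.* (1 ℕ.+ binom n 1) ℕ.+ 0
    ≡⟨ regroup (binom n 1) ⟩
  1 ℕ.+ (1 ℕ.* binom n 1 ℕ.+ 0)
    ≡⟨ cong (1 ℕ.+_) (binom-absorb n 0) ⟩
  suc n ℕ.* 1 ∎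
  where
  open ≡-Reasoning
  regroup : ∀ b → 1 ℕ.* (1 ℕ.+ b) ℕ.+ 0 ≡ 1 ℕ.+ (1 ℕ.* b ℕ.+ 0)
  regroup = ℕSolver.solve-∀
binom-absorb (suc n) (suc k) = begin
  (2 ℕ.+ k) ℕ.* binom (suc n) (2 ℕ.+ k) ℕ.+ (1 ℕ.+ k) ℕ.* binom (suc n) (1 ℕ.+ k)
    ≡⟨ cong₂ (λ u v → (2 ℕ.+ k) ℕ.* u ℕ.+ (1 ℕ.+ k) ℕ.* v) (pascal (suc k)) (pascal k) ⟨
  (2 ℕ.+ k) ℕ.* (b ℕ.+ c) ℕ.+ (1 ℕ.+ k) ℕ.* (a ℕ.+ b)
    ≡⟨ regroup k a b c ⟩
  ((2 ℕ.+ k) ℕ.* c ℕ.+ (1 ℕ.+ k) ℕ.* b) ℕ.+ ((1 ℕ.+ k) ℕ.* b ℕ.+ k ℕ.* a) ℕ.+ (a ℕ.+ b)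
    ≡⟨ cong₂ (λ u v → u ℕ.+ v ℕ.+ (a ℕ.+ b)) (binom-absorb n (suc k)) (binom-absorb n k) ⟩
  n ℕ.* b ℕ.+ n ℕ.* a ℕ.+ (a ℕ.+ b)
    ≡⟨ collect n a b ⟩
  suc n ℕ.* (a ℕ.+ b)
    ≡⟨ cong (suc n ℕ.*_) (pascal k) ⟩
  suc n ℕ.* binom (suc n) (suc k) ∎
  where
  open ≡-Reasoning
  pascal = nCk+nC[k+1]≡[n+1]C[k+1] n
  a = binom n k
  b = binom n (suc k)
  c = binom n (suc (suc k))
  regroup : ∀ k a b c → (2 ℕ.+ k) ℕ.* (b ℕ.+ c) ℕ.+ (1 ℕ.+ k) ℕ.* (a ℕ.+ b) ≡
    ((2 ℕ.+ k) ℕ.* c ℕ.+ (1 ℕ.+ k) ℕ.* b) ℕ.+ ((1 ℕ.+ k) ℕ.* b ℕ.+ k ℕ.* a) ℕ.+ (a ℕ.+ b)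
  regroup = ℕSolver.solve-∀
  collect : ∀ n a b → n ℕ.* b ℕ.+ n ℕ.* a ℕ.+ (a ℕ.+ b) ≡ (1 ℕ.+ n) ℕ.* (a ℕ.+ b)
  collect = ℕSolver.solve-∀

sign : ℕ → ℤ
sign j = if oddᵇ j then -1ℤ else 1ℤ

sign-suc : ∀ j → sign (suc j) ≡ - sign j
sign-suc j with oddᵇ j
... | true = refl
... | false = refl

-- The coefficient of t^j in (1 - t)^h.
signedBinom : ℕ → ℕ → ℤ
signedBinom h j = sign j * + binom h j

binom-absorbℤ : ∀ n k → (+ 1 + + k) * + binom n (suc k) + + k * + binom n k ≡ + n * + binom n k
binom-absorbℤ n k = begin
  (+ 1 + + k) * + b + + k * + a      ≡⟨ cong₂ _+_ (pos-* (suc k) b) (pos-* k a) ⟨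
  + (suc k ℕ.* b) + + (k ℕ.* a)      ≡⟨ pos-+ (suc k ℕ.* b) _ ⟨
  + (suc k ℕ.* b ℕ.+ k ℕ.* a)        ≡⟨ cong +_ (binom-absorb n k) ⟩
  + (n ℕ.* a)                        ≡⟨ pos-* n a ⟩
  + n * + a                          ∎
  where
  open ≡-Reasoning
  a = binom n k
  b = binom n (suc k)

signedBinom-rec : ∀ h j → (+ 1 + + j) * signedBinom h (suc j) ≡ (+ j - + h) * signedBinom h j
signedBinom-rec h j = begin
  (+ 1 + + j) * (sign (suc j) * b)    ≡⟨ cong (λ s → (+ 1 + + j) * (s * b)) (sign-suc j) ⟩
  (+ 1 + + j) * (- sign j * b)        ≡⟨ isolate (+ j) (sign j) a b ⟩
  - sign j * ((+ 1 + + j) * b + + j * a) + + j * (sign j * a)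
    ≡⟨ cong (λ u → - sign j * u + + j * (sign j * a)) (binom-absorbℤ h j) ⟩
  - sign j * (+ h * a) + + j * (sign j * a)
    ≡⟨ collect (+ j) (+ h) (sign j) a ⟩
  (+ j - + h) * (sign j * a) ∎
  where
  open ≡-Reasoning
  a = + binom h j
  b = + binom h (suc j)
  isolate : ∀ j s a b → (+ 1 + j) * (- s * b) ≡ - s * ((+ 1 + j) * b + j * a) + j * (s * a)
  isolate = solve-∀
  collect : ∀ j h s a → - s * (h * a) + j * (s * a) ≡ (j - h) * (s * a)
  collect = solve-∀

-- Evaluation of `Δ` at even and odd indices.

module Δ-values (ν : ℕ) where

  private
    at-0 : ∀ i → i % 4 ≡ 0 → Δ ν i ≡ + binom ν (i / 2)
    at-0 i eq with i % 4 | eq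
    ... | .0 | refl = refl

    at-1 : ∀ i → i % 4 ≡ 1 → Δ ν i ≡ - + binom ν (i / 2)
    at-1 i eq with i % 4 | eq
    ... | .1 | refl = refl

    at-2 : ∀ i → i % 4 ≡ 2 → Δ ν i ≡ - + binom ν (i / 2)
    at-2 i eq with i % 4 | eq
    ... | .2 | refl = refl

    at-3 : ∀ i → i % 4 ≡ 3 → Δ ν i ≡ + binom ν (i / 2)
    at-3 i eq with i % 4 | eq
    ... | .3 | refl = refl

    drop-4 : ∀ i → (4 ℕ.+ i) % 4 ≡ i % 4
    drop-4 i = trans (cong (_% 4) (ℕ.+-comm 4 i)) ([m+n]%n≡m%n i 4)

    even%4 : ∀ j → (j ℕ.* 2) % 4 ≡ (if oddᵇ j then 2 else 0)
    even%4 zero = refl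
    even%4 (suc zero) = refl
    even%4 (suc (suc j)) rewrite not-involutive (oddᵇ j) = trans (drop-4 (j ℕ.* 2)) (even%4 j)

    odd%4 : ∀ j → suc (j ℕ.* 2) % 4 ≡ (if oddᵇ j then 3 else 1)
    odd%4 zero = refl
    odd%4 (suc zero) = refl
    odd%4 (suc (suc j)) rewrite not-involutive (oddᵇ j) = trans (drop-4 (suc (j ℕ.* 2))) (odd%4 j)

    odd/2 : ∀ j → suc (j ℕ.* 2) / 2 ≡ j
    odd/2 j = trans (+-distrib-/-∣ʳ 1 {d = 2} (divides-refl j)) (m*n/n≡m j 2)

  Δ-even : ∀ j → Δ ν (j ℕ.* 2) ≡ signedBinom ν j
  Δ-even j = trans (by-value (oddᵇ j) (even%4 j))
    (cong (λ k → sign j * + binom ν k) (m*n/n≡m j 2))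
    where
    by-value : ∀ b → (j ℕ.* 2) % 4 ≡ (if b then 2 else 0) →
      Δ ν (j ℕ.* 2) ≡ (if b then -1ℤ else 1ℤ) * + binom ν (j ℕ.* 2 / 2)
    by-value true eq = trans (at-2 (j ℕ.* 2) eq) (sym (-1*i≡-i _))
    by-value false eq = trans (at-0 (j ℕ.* 2) eq) (sym (*-identityˡ _))

  Δ-odd : ∀ j → Δ ν (suc (j ℕ.* 2)) ≡ - signedBinom ν j
  Δ-odd j = trans (by-value (oddᵇ j) (odd%4 j))
    (cong (λ k → - (sign j * + binom ν k)) (odd/2 j))
    where
    by-value : ∀ b → suc (j ℕ.* 2) % 4 ≡ (if b then 3 else 1) →
      Δ ν (suc (j ℕ.* 2)) ≡ - ((if b then -1ℤ else 1ℤ) * + binom ν (suc (j ℕ.* 2) / 2))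
    by-value true eq = trans (at-3 (suc (j ℕ.* 2)) eq) (sym (trans (cong -_ (-1*i≡-i _)) (neg-involutive _)))
    by-value false eq = trans (at-1 (suc (j ℕ.* 2)) eq) (cong -_ (sym (*-identityˡ _)))

  -- The `Δ ν i` are the coefficients of (1 - z)(1 - z²)^ν, so sums of neighbours are coefficients
  -- of (1 + z)(1 - z)(1 - z²)^ν = (1 - z²)^(ν+1). On coefficients this is Pascal's rule, as the two
  -- terms have the same sign.
  Δ-pair : ∀ j → Δ ν (suc (j ℕ.* 2)) + Δ ν (suc j ℕ.* 2) ≡ signedBinom (suc ν) (suc j)
  Δ-pair j = begin
    Δ ν (suc (j ℕ.* 2)) + Δ ν (suc j ℕ.* 2)
      ≡⟨ cong₂ _+_ (Δ-odd j) (Δ-even (suc j)) ⟩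
    - (sign j * + binom ν j) + sign (suc j) * + binom ν (suc j)
      ≡⟨ cong (λ s → - (sign j * + binom ν j) + s * + binom ν (suc j)) (sign-suc j) ⟩
    - (sign j * + binom ν j) + - sign j * + binom ν (suc j)
      ≡⟨ collect (sign j) (+ binom ν j) (+ binom ν (suc j)) ⟩
    - sign j * (+ binom ν j + + binom ν (suc j))
      ≡⟨ cong₂ _*_ (sym (sign-suc j)) (trans (sym (pos-+ (binom ν j) _)) (cong +_ (nCk+nC[k+1]≡[n+1]C[k+1] ν j))) ⟩
    sign (suc j) * + binom (suc ν) (suc j) ∎
    where
    open ≡-Reasoning
    collect : ∀ s a b → - (s * a) + - s * b ≡ - s * (a + b)
    collect = solve-∀

-- The recurrence says that s_i - (m + 1 choose i) / m is an eigenvector for the eigenvalue 1 of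
-- the weight-layer matrix of the (m + 1)-cube; its entries are proportional to the coefficients
-- of (1 + z) (1 - z²)^h, the entries at 2j and 2j + 1 being (-1)^j (h choose j).
module LayerRecurrence (h : ℕ) (s : ℕ → ℕ) (s-one : s 1 ≡ suc (s 0))
  (s-rec : ∀ i → (2 ℕ.+ i) ℕ.* s (2 ℕ.+ i) ℕ.+ suc (2 ℕ.* h) ℕ.* s i ≡
    binom (suc (2 ℕ.* h)) (suc i) ℕ.+ s (suc i) ℕ.+ i ℕ.* s i) where

  -- Closed form of the layer sums.

  private
    m : ℕ
    m = 2 ℕ.* h

    c : ℕ → ℤ
    c i = + binom (suc m) i

    -- m times the entry of the eigenvector at weight 0, that is m(s_0 - 1/m).
    K : ℤ
    K = + m * + s 0 - + 1

    -- Multiplied by m to stay within the integers; `x` is the eigenvector entry at weight i, scaled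
    -- to be 1 at weight 0.
    Closed : ℕ → ℤ → Set
    Closed i x = + m * + s i ≡ c i + K * x

    s-recℤ : ∀ i → (+ 2 + + i) * + s (2 ℕ.+ i) + (+ 1 + + m) * + s i ≡ c (suc i) + + s (suc i) + + i * + s i
    s-recℤ i = begin
      + (2 ℕ.+ i) * + s (2 ℕ.+ i) + + suc m * + s i
        ≡⟨ cong₂ _+_ (pos-* (2 ℕ.+ i) (s (2 ℕ.+ i))) (pos-* (suc m) (s i)) ⟨
      + ((2 ℕ.+ i) ℕ.* s (2 ℕ.+ i)) + + (suc m ℕ.* s i)
        ≡⟨ pos-+ ((2 ℕ.+ i) ℕ.* s (2 ℕ.+ i)) _ ⟨
      + ((2 ℕ.+ i) ℕ.* s (2 ℕ.+ i) ℕ.+ suc m ℕ.* s i)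
        ≡⟨ cong +_ (s-rec i) ⟩
      + (binom (suc m) (suc i) ℕ.+ s (suc i) ℕ.+ i ℕ.* s i)
        ≡⟨ pos-+ (binom (suc m) (suc i) ℕ.+ s (suc i)) _ ⟩
      + (binom (suc m) (suc i) ℕ.+ s (suc i)) + + (i ℕ.* s i)
        ≡⟨ cong₂ _+_ (pos-+ (binom (suc m) (suc i)) _) (pos-* i _) ⟩
      c (suc i) + + s (suc i) + + i * + s i ∎
      where open ≡-Reasoning

    -- The first hypothesis is the homogeneous recurrence for the eigenvector entries `x`, `y`, `z`
    -- at three consecutive weights. The binomial part solves the inhomogeneous recurrence, so the
    -- sum of both obeys `s-recℤ`, which determines the next layer.
    closed-step : ∀ i {x y z} → (+ 2 + + i) * z + (+ 1 + + m - + i) * x ≡ y →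
      Closed i x → Closed (1 ℕ.+ i) y → Closed (2 ℕ.+ i) z
    closed-step i {x} {y} {z} xyz p q = *-cancelˡ-≡ (+ (2 ℕ.+ i)) _ _ (begin
      (+ 2 + + i) * (+ m * s₂)
        ≡⟨ isolate (+ m) (+ i) s₀ s₂ ⟩
      + m * ((+ 2 + + i) * s₂ + (+ 1 + + m) * s₀) - (+ 1 + + m) * (+ m * s₀)
        ≡⟨ cong (λ u → + m * u - (+ 1 + + m) * (+ m * s₀)) (s-recℤ i) ⟩
      + m * (c₁ + s₁ + + i * s₀) - (+ 1 + + m) * (+ m * s₀)
        ≡⟨ distribute (+ m) (+ i) c₁ s₁ s₀ ⟩
      + m * c₁ + + m * s₁ + (+ i - + 1 - + m) * (+ m * s₀)
        ≡⟨ cong₂ (λ u v → + m * c₁ + u + (+ i - + 1 - + m) * v) q p ⟩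
      + m * c₁ + (c₁ + K * y) + (+ i - + 1 - + m) * (c₀ + K * x)
        ≡⟨ cong (λ u → + m * c₁ + (c₁ + K * u) + (+ i - + 1 - + m) * (c₀ + K * x)) (sym xyz) ⟩
      + m * c₁ + (c₁ + K * ((+ 2 + + i) * z + (+ 1 + + m - + i) * x)) + (+ i - + 1 - + m) * (c₀ + K * x)
        ≡⟨ cancel (+ m) (+ i) c₀ c₁ K x z ⟩
      (+ 1 + + m) * c₁ + + i * c₀ - (+ 1 + + m) * c₀ + (+ 2 + + i) * (K * z)
        -- Absorption at i + 1 and at i reduces the binomial terms to (i + 2) `c₂`.
        ≡⟨ cong₂ (λ u v → u + + i * c₀ - v + (+ 2 + + i) * (K * z))
             (sym (binom-absorbℤ (suc m) (suc i))) (sym (binom-absorbℤ (suc m) i)) ⟩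
      ((+ 1 + + suc i) * c₂ + + suc i * c₁) + + i * c₀ - ((+ 1 + + i) * c₁ + + i * c₀) + (+ 2 + + i) * (K * z)
        ≡⟨ collect (+ i) c₀ c₁ c₂ (K * z) ⟩
      (+ 2 + + i) * (c₂ + K * z) ∎)
      where
      open ≡-Reasoning
      s₀ = + s i
      s₁ = + s (suc i)
      s₂ = + s (suc (suc i))
      c₀ = c i
      c₁ = c (suc i)
      c₂ = c (suc (suc i))
      isolate : ∀ m i s₀ s₂ → (+ 2 + i) * (m * s₂) ≡
        m * ((+ 2 + i) * s₂ + (+ 1 + m) * s₀) - (+ 1 + m) * (m * s₀)
      isolate = solve-∀
      distribute : ∀ m i c₁ s₁ s₀ → m * (c₁ + s₁ + i * s₀) - (+ 1 + m) * (m * s₀) ≡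
        m * c₁ + m * s₁ + (i - + 1 - m) * (m * s₀)
      distribute = solve-∀
      cancel : ∀ m i c₀ c₁ K x z →
        m * c₁ + (c₁ + K * ((+ 2 + i) * z + (+ 1 + m - i) * x)) + (i - + 1 - m) * (c₀ + K * x) ≡
        (+ 1 + m) * c₁ + i * c₀ - (+ 1 + m) * c₀ + (+ 2 + i) * (K * z)
      cancel = solve-∀
      collect : ∀ i c₀ c₁ c₂ w →
        ((+ 1 + (+ 1 + i)) * c₂ + (+ 1 + i) * c₁) + i * c₀ - ((+ 1 + i) * c₁ + i * c₀) + (+ 2 + i) * w ≡
        (+ 2 + i) * (c₂ + w)
      collect = solve-∀

    d : ℕ → ℤ
    d = signedBinom h

    -- The entries at 2j, 2j + 1, 2j + 2 are d_j, d_j, d_(j+1). As m = 2h, twice `signedBinom-rec`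
    -- cancels all but one copy of d_j.
    to-even : ∀ j → (+ 2 + + (j ℕ.* 2)) * d (suc j) + (+ 1 + + m - + (j ℕ.* 2)) * d j ≡ d j
    to-even j = begin
      (+ 2 + + (j ℕ.* 2)) * d (suc j) + (+ 1 + + m - + (j ℕ.* 2)) * d j
        ≡⟨ cong₂ (λ u v → (+ 2 + u) * d (suc j) + (+ 1 + v - u) * d j) (pos-* j 2) (pos-* 2 h) ⟩
      (+ 2 + + j * + 2) * d (suc j) + (+ 1 + + 2 * + h - + j * + 2) * d j
        ≡⟨ factor (+ j) (+ h) (d j) (d (suc j)) ⟩
      + 2 * ((+ 1 + + j) * d (suc j)) + (+ 1 + + 2 * + h - + j * + 2) * d j
        ≡⟨ cong (λ u → + 2 * u + (+ 1 + + 2 * + h - + j * + 2) * d j) (signedBinom-rec h j) ⟩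
      + 2 * ((+ j - + h) * d j) + (+ 1 + + 2 * + h - + j * + 2) * d j
        ≡⟨ collect (+ j) (+ h) (d j) ⟩
      d j ∎
      where
      open ≡-Reasoning
      factor : ∀ j h x z → (+ 2 + j * + 2) * z + (+ 1 + + 2 * h - j * + 2) * x ≡
        + 2 * ((+ 1 + j) * z) + (+ 1 + + 2 * h - j * + 2) * x
      factor = solve-∀
      collect : ∀ j h x → + 2 * ((j - h) * x) + (+ 1 + + 2 * h - j * + 2) * x ≡ x
      collect = solve-∀

    -- The same cancellation for the entries d_j, d_(j+1), d_(j+1) at 2j + 1, 2j + 2, 2j + 3; now
    -- one copy of d_(j+1) is left.
    to-odd : ∀ j → (+ 2 + + suc (j ℕ.* 2)) * d (suc j) + (+ 1 + + m - + suc (j ℕ.* 2)) * d j ≡ d (suc j)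
    to-odd j = begin
      (+ 2 + (+ 1 + + (j ℕ.* 2))) * d (suc j) + (+ 1 + + m - (+ 1 + + (j ℕ.* 2))) * d j
        ≡⟨ cong₂ (λ u v → (+ 2 + (+ 1 + u)) * d (suc j) + (+ 1 + v - (+ 1 + u)) * d j) (pos-* j 2) (pos-* 2 h) ⟩
      (+ 2 + (+ 1 + + j * + 2)) * d (suc j) + (+ 1 + + 2 * + h - (+ 1 + + j * + 2)) * d j
        ≡⟨ factor (+ j) (+ h) (d j) (d (suc j)) ⟩
      + 2 * ((+ 1 + + j) * d (suc j)) + d (suc j) + (+ 2 * + h - + j * + 2) * d j
        ≡⟨ cong (λ u → + 2 * u + d (suc j) + (+ 2 * + h - + j * + 2) * d j) (signedBinom-rec h j) ⟩
      + 2 * ((+ j - + h) * d j) + d (suc j) + (+ 2 * + h - + j * + 2) * d j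
        ≡⟨ collect (+ j) (+ h) (d j) (d (suc j)) ⟩
      d (suc j) ∎
      where
      open ≡-Reasoning
      factor : ∀ j h x z → (+ 2 + (+ 1 + j * + 2)) * z + (+ 1 + + 2 * h - (+ 1 + j * + 2)) * x ≡
        + 2 * ((+ 1 + j) * z) + z + (+ 2 * h - j * + 2) * x
      factor = solve-∀
      collect : ∀ j h x z → + 2 * ((j - h) * x) + z + (+ 2 * h - j * + 2) * x ≡ z
      collect = solve-∀

    closed-zero : Closed 0 (d 0)
    closed-zero = expand (+ m) (+ s 0)
      where
      expand : ∀ m s → m * s ≡ + 1 + (m * s - + 1) * + 1
      expand = solve-∀

    -- The entries at weights 0 and 1 agree because passing from weight 0 to 1 adds m on both sides:
    -- 1 to s, and m to the binomial coefficient.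
    closed-one : Closed 1 (d 0)
    closed-one = begin
      + m * + s 1                 ≡⟨ cong (λ u → + m * + u) s-one ⟩
      + m * (+ 1 + + s 0)         ≡⟨ expand (+ m) (+ s 0) ⟩
      + 1 + + m + K * + 1         ≡⟨ cong (λ u → + u + K * + 1) (sym one) ⟩
      c 1 + K * + 1               ∎
      where
      open ≡-Reasoning
      one : binom (suc m) 1 ≡ suc m
      one = trans (sym (trans (ℕ.+-identityʳ _) (ℕ.+-identityʳ _)))
        (trans (binom-absorb (suc m) 0) (ℕ.*-identityʳ (suc m)))
      expand : ∀ m s → m * (+ 1 + s) ≡ + 1 + m + (m * s - + 1) * + 1
      expand = solve-∀

    closed : ∀ j → Closed (j ℕ.* 2) (d j) × Closed (suc (j ℕ.* 2)) (d j)
    closed zero = closed-zero , closed-one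
    closed (suc j) = even , closed-step (suc (j ℕ.* 2)) (to-odd j) (proj₂ (closed j)) even
      where
      even : Closed (suc j ℕ.* 2) (d (suc j))
      even = closed-step (j ℕ.* 2) (to-even j) (proj₁ (closed j)) (proj₂ (closed j))

  closed-even : ∀ j → + m * + s (j ℕ.* 2) ≡ + binom (suc m) (j ℕ.* 2) + (+ m * + s 0 - + 1) * signedBinom h j
  closed-even j = proj₁ (closed j)

  closed-odd : ∀ j → + m * + s (suc (j ℕ.* 2)) ≡
    + binom (suc m) (suc (j ℕ.* 2)) + (+ m * + s 0 - + 1) * signedBinom h j
  closed-odd j = proj₂ (closed j)

-- Indices of given parity.

even⇒double : ∀ i → Even i → ∃ λ j → i ≡ j ℕ.* 2
even⇒double i eq = i / 2 , trans (m≡m%n+[m/n]*n i 2) (cong (ℕ._+ i / 2 ℕ.* 2) eq)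

odd⇒suc-double : ∀ i → Odd i → ∃ λ j → i ≡ suc (j ℕ.* 2)
odd⇒suc-double i eq = i / 2 , trans (m≡m%n+[m/n]*n i 2) (cong (ℕ._+ i / 2 ℕ.* 2) eq)

oddᵇ-double : ∀ j → oddᵇ (j ℕ.* 2) ≡ false
oddᵇ-double zero = refl
oddᵇ-double (suc j) = cong (not ∘ not) (oddᵇ-double j)

oddᵇ-even : ∀ i → Even i → oddᵇ i ≡ false
oddᵇ-even i e with even⇒double i e
... | j , refl = oddᵇ-double j

oddᵇ-odd : ∀ i → Odd i → oddᵇ i ≡ true
oddᵇ-odd i e with odd⇒suc-double i e
... | j , refl = cong not (oddᵇ-double j)

n≤2^n : ∀ r → r ≤ 2 ^ r
n≤2^n zero = z≤n
n≤2^n (suc r) = ℕ.+-mono-≤ (ℕ.m^n>0 2 r) (subst (r ≤_) (sym (ℕ.+-identityʳ (2 ^ r))) (n≤2^n r))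

-- Weight distribution of an extended code.

module ENP1CC (q : ℕ) (Cs : Code (suc (2 ^ suc q))) (C : Code (2 ^ suc q)) (β : Bool)
  (np : IsNP1CC (suc q) C) (Cs-def : ∀ w → Cs w ≡ extend C β w) where

  h m ν : ℕ
  h = 2 ^ q
  m = 2 ^ suc q
  ν = h ∸ 1

  suc-ν : suc ν ≡ h
  suc-ν = ℕ.m+[n∸m]≡n (ℕ.m^n>0 2 q)

  size : 2 ^ m ≡ m ℕ.* sumʷ (bit ∘ C)
  size = begin
    -- The exponent m - r in the cardinality is a true difference since r ≤ 2^r.
    2 ^ m                              ≡⟨ cong (2 ^_) (ℕ.m+[n∸m]≡n (n≤2^n (suc q))) ⟨
    2 ^ (suc q ℕ.+ (m ∸ suc q))        ≡⟨ ℕ.^-distribˡ-+-* 2 (suc q) (m ∸ suc q) ⟩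
    m ℕ.* 2 ^ (m ∸ suc q)              ≡⟨ cong (m ℕ.*_) (proj₁ np) ⟨
    m ℕ.* card C                       ≡⟨ cong (m ℕ.*_) (card≡sumʷ C) ⟩
    m ℕ.* sumʷ (bit ∘ C)               ∎
    where open ≡-Reasoning

  open NearlyPerfect C h refl size (covering⇒ball C (proj₂ np)) using (excess; ball-f; ball-excess≡)
  open Extended C excess ball-f ball-excess≡ β Cs Cs-def public

  s : ℕ → ℕ
  s = layer lift

  open LayerRecurrence h s layer-lift-one layer-lift-rec
  open Δ-values ν

  -- The closed form depends on the code only through s_0: the value 1 gives the coefficient n - 1
  -- of the theorem, and the value 0 gives -1.
  coefficient-one : s 0 ≡ 1 → + m * + s 0 - + 1 ≡ + (m ∸ 1)
  coefficient-one s₀ = begin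
    + m * + s 0 - + 1          ≡⟨ cong (λ u → + m * + u - + 1) s₀ ⟩
    + m * + 1 - + 1            ≡⟨ cong (_- + 1) (*-identityʳ (+ m)) ⟩
    + m - + 1                  ≡⟨ cong (λ u → + u - + 1) (ℕ.m+[n∸m]≡n (ℕ.m^n>0 2 (suc q))) ⟨
    + (m ∸ 1)                  ∎
    where open ≡-Reasoning

  coefficient-zero : s 0 ≡ 0 → ∀ x y → x + (+ m * + s 0 - + 1) * y ≡ x - y
  coefficient-zero s₀ x y = trans (cong (λ u → x + (+ m * + u - + 1) * y) s₀) (simplify (+ m) x y)
    where
    simplify : ∀ m x y → x + (m * + 0 - + 1) * y ≡ x - y
    simplify = solve-∀

  Δ-pairʰ : ∀ j → Δ ν (suc (j ℕ.* 2)) + Δ ν (suc j ℕ.* 2) ≡ signedBinom h (suc j)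
  Δ-pairʰ j = trans (Δ-pair j) (cong (λ k → signedBinom k (suc j)) suc-ν)

  A-even : β ≡ false → ∀ i → Even i → 0 < i →
    + m * + A Cs i ≡ + binom (suc m) i + (+ m * + s 0 - + 1) * (Δ ν (i ∸ 1) + Δ ν i)
  A-even β≡ i e 0<i with even⇒double i e
  A-even β≡ .0 e () | zero , refl
  A-even β≡ i@.(suc j ℕ.* 2) e 0<i | suc j , refl = begin
    + m * + A Cs i
      ≡⟨ cong (λ u → + m * + u) (A≡layer-lift i (trans (oddᵇ-even i e) (sym β≡))) ⟩
    + m * + s i
      ≡⟨ closed-even (suc j) ⟩
    + binom (suc m) i + (+ m * + s 0 - + 1) * signedBinom h (suc j)
      ≡⟨ cong (λ u → + binom (suc m) i + (+ m * + s 0 - + 1) * u) (Δ-pairʰ j) ⟨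
    + binom (suc m) i + (+ m * + s 0 - + 1) * (Δ ν (i ∸ 1) + Δ ν i) ∎
    where open ≡-Reasoning

  A-odd : β ≡ true → ∀ i → Odd i → 1 < i →
    + m * + A Cs i ≡ + binom (suc m) i + (+ m * + s 0 - + 1) * (Δ ν (i ∸ 1) + Δ ν (i ∸ 2))
  A-odd β≡ i o 1<i with odd⇒suc-double i o
  A-odd β≡ .1 o (s≤s ()) | zero , refl
  A-odd β≡ i@.(suc (suc j ℕ.* 2)) o 1<i | suc j , refl = begin
    + m * + A Cs i
      ≡⟨ cong (λ u → + m * + u) (A≡layer-lift i (trans (oddᵇ-odd i o) (sym β≡))) ⟩
    + m * + s i
      ≡⟨ closed-odd (suc j) ⟩
    + binom (suc m) i + (+ m * + s 0 - + 1) * signedBinom h (suc j)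
      -- The entry at 2j + 3 equals the one at 2j + 2, hence the indices i - 1 and i - 2 instead of
      -- i and i - 1.
      ≡⟨ cong (λ u → + binom (suc m) i + (+ m * + s 0 - + 1) * u)
           (trans (+-comm (Δ ν (i ∸ 1)) _) (Δ-pairʰ j)) ⟨
    + binom (suc m) i + (+ m * + s 0 - + 1) * (Δ ν (i ∸ 1) + Δ ν (i ∸ 2)) ∎
    where open ≡-Reasoning

  A-zero : A Cs 0 ≡ bit (Cs (zeroWord (suc m)))
  A-zero = trans (A≡layer Cs 0) (layer-at-zero (bit ∘ Cs))

  -- For a code of odd words `s 0` is the excess of the zero word, and it is read off from the
  -- number of codewords of weight one.
  A-one : β ≡ true → A Cs 1 ≡ suc (s 0)
  A-one refl = trans (A≡layer-lift 1 refl) layer-lift-one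

  zeroed⇒even : Zeroed Cs → β ≡ false
  zeroed⇒even z = by-value β refl
    where
    by-value : ∀ b → β ≡ b → b ≡ false
    by-value false _ = refl
    by-value true eq = contradiction
      (trans (sym (A≡0 0 (sym (cong not eq)))) (trans A-zero (cong bit z))) λ ()

  A-one⇒odd : ∀ {k} → A Cs 1 ≡ suc k → β ≡ true
  A-one⇒odd a₁ = by-value β refl
    where
    by-value : ∀ b → β ≡ b → b ≡ true
    by-value true _ = refl
    by-value false eq = contradiction (trans (sym (A≡0 1 (sym (cong not eq)))) a₁) λ ()

  -- If `β` were true, `A-one` would provide at least one codeword of weight 1, which is odd.
  all-even⇒even : (∀ w → Cs w ≡ true → Even (weight w)) → β ≡ false
  all-even⇒even all-even = by-value β refl
    where
    no-weight-one : ∀ w → weight w ≡ 1 → bit (Cs w) ≡ 0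
    no-weight-one w wt with Cs w in eq
    ... | false = refl
    ... | true = contradiction (trans (sym (cong (_% 2) wt)) (all-even w eq)) λ ()
    by-value : ∀ b → β ≡ b → b ≡ false
    by-value false _ = refl
    by-value true eq = contradiction (begin
      suc (s 0)                          ≡⟨ A-one eq ⟨
      A Cs 1                             ≡⟨ A≡layer Cs 1 ⟩
      layer (bit ∘ Cs) 1                 ≡⟨ layer-cong-weight 1 no-weight-one ⟩
      layer {suc m} (λ _ → 0) 1          ≡⟨ layer-zero (suc m) 1 ⟩
      0                                  ∎) λ ()
      where open ≡-Reasoning

  no-odd : β ≡ false → ∀ i → Odd i → A Cs i ≡ 0
  no-odd eq i o = A≡0 i (trans (oddᵇ-odd i o) (sym (cong not eq)))

  no-even : β ≡ true → ∀ i → Even i → A Cs i ≡ 0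
  no-even eq i e = A≡0 i (trans (oddᵇ-even i e) (sym (cong not eq)))

  s-zero : β ≡ false → s 0 ≡ A Cs 0
  s-zero eq = sym (A≡layer-lift 0 (sym eq))

  not-zeroed⇒A-zero : ¬ Zeroed Cs → A Cs 0 ≡ 0
  not-zeroed⇒A-zero ¬z with Cs (zeroWord (suc m)) in eq
  ... | true = contradiction refl ¬z
  ... | false = trans A-zero (cong bit eq)

theorem6 : (r : ℕ) → 2 ≤ r → (Cs : Code (suc (2 ^ r))) → IsENP1CC r Cs →
    (Zeroed Cs →
    ((i : ℕ) → Odd i → A Cs i ≡ 0) × (A Cs 0 ≡ 1) ×
    ((i : ℕ) → Even i → 0 < i →
    + (2 ^ r) * + (A Cs i)
    ≡ + binom (suc (2 ^ r)) i
    + + (2 ^ r ∸ 1) * (Δ (2 ^ (r ∸ 1) ∸ 1) (i ∸ 1) + Δ (2 ^ (r ∸ 1) ∸ 1) i)))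
    ×
    (¬ Zeroed Cs → A Cs 1 ≡ 1 →
    ((i : ℕ) → Even i → A Cs i ≡ 0) × (A Cs 1 ≡ 1) ×
    ((i : ℕ) → Odd i → 1 < i →
    + (2 ^ r) * + (A Cs i)
    ≡ + binom (suc (2 ^ r)) i
    - (Δ (2 ^ (r ∸ 1) ∸ 1) (i ∸ 1) + Δ (2 ^ (r ∸ 1) ∸ 1) (i ∸ 2))))
    ×
    (¬ Zeroed Cs → A Cs 1 ≡ 2 →
    ((i : ℕ) → Even i → A Cs i ≡ 0) × (A Cs 1 ≡ 2) ×
    ((i : ℕ) → Odd i → 1 < i →
    + (2 ^ r) * + (A Cs i)
    ≡ + binom (suc (2 ^ r)) i
    + + (2 ^ r ∸ 1) * (Δ (2 ^ (r ∸ 1) ∸ 1) (i ∸ 1) + Δ (2 ^ (r ∸ 1) ∸ 1) (i ∸ 2))))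
    ×
    (¬ Zeroed Cs → ((w : Word (suc (2 ^ r))) → Cs w ≡ true → Even (weight w)) →
    ((i : ℕ) → Odd i → A Cs i ≡ 0) × (A Cs 0 ≡ 0) ×
    ((i : ℕ) → Even i → 0 < i →
    + (2 ^ r) * + (A Cs i)
    ≡ + binom (suc (2 ^ r)) i
    - (Δ (2 ^ (r ∸ 1) ∸ 1) i + Δ (2 ^ (r ∸ 1) ∸ 1) (i ∸ 1))))
theorem6 (suc q) 2≤r Cs (C , β , np , Cs-def) = case₁ , case₂ , case₃ , case₄
  where
  open ENP1CC q Cs C β np Cs-def
  -- In the even cases 1 and 4, s_0 is A_0, namely 1 or 0 as the zero word is a codeword or not. In
  -- the odd cases 2 and 3, s_0 is A_1 - 1, namely 0 and 1.
  case₁ = λ z →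
    let even = zeroed⇒even z
        A₀ = trans A-zero (cong bit z)
    in no-odd even , A₀ , λ i e 0<i → trans (A-even even i e 0<i)
      (cong (λ u → + binom (suc m) i + u * (Δ ν (i ∸ 1) + Δ ν i)) (coefficient-one (trans (s-zero even) A₀)))
  case₂ = λ _ A₁ →
    let odd = A-one⇒odd A₁
        s₀ = ℕ.suc-injective (trans (sym (A-one odd)) A₁)
    in no-even odd , A₁ , λ i o 1<i → trans (A-odd odd i o 1<i)
      (coefficient-zero s₀ (+ binom (suc m) i) (Δ ν (i ∸ 1) + Δ ν (i ∸ 2)))
  case₃ = λ _ A₁ →
    let odd = A-one⇒odd A₁
        s₀ = ℕ.suc-injective (trans (sym (A-one odd)) A₁)
    in no-even odd , A₁ , λ i o 1<i → trans (A-odd odd i o 1<i)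
      (cong (λ u → + binom (suc m) i + u * (Δ ν (i ∸ 1) + Δ ν (i ∸ 2))) (coefficient-one s₀))
  case₄ = λ ¬z all-even →
    let even = all-even⇒even all-even
        A₀ = not-zeroed⇒A-zero ¬z
    in no-odd even , A₀ , λ i e 0<i → trans (A-even even i e 0<i)
      (trans (coefficient-zero (trans (s-zero even) A₀) (+ binom (suc m) i) (Δ ν (i ∸ 1) + Δ ν i))
             (cong (λ u → + binom (suc m) i - u) (+-comm (Δ ν (i ∸ 1)) (Δ ν i))))
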